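{- Every $2$-saturated subcubic graph $G$ such that $g_3(G)=3$ is $(2,2,2,2,2)$-packing colorable.
   Context: All graphs are finite, simple and undirected. For a non-decreasing sequence $S=(s_1,\dots,s_k)$ of positive integers, an $S$-packing coloring of $G$ is a partition of $V(G)$ into sets $V_1,\dots,V_k$ such that any two distinct vertices $u,v\in V_i$ satisfy $dist_G(u,v)>s_i$; $G$ is $S$-packing colorable if it admits one. $G$ is subcubic if its maximum degree is at most $3$. A subcubic graph is $k$-saturated if every vertex of degree $3$ is adjacent to at most $k$ vertices of degree $3$. The local girth $g(v)$ of a vertex $v$ is the length of a shortest cycle containing $v$ ($\infty$ if none), and $g_3(G)=\max\{g(v): d_G(v)=3\}$. -}

module Defs where

open import Data.Nat using (ℕ; zero; suc; _≤_; _<_)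
open import Data.Fin using (Fin)
open import Data.Bool using (Bool; true; false; T)
open import Data.Bool.Properties using (T?)
open import Data.List using (List; []; _∷_; length; filter; allFin)
open import Data.List.Relation.Unary.Unique.Propositional using (Unique)
open import Data.List.Relation.Unary.Linked using (Linked)
open import Data.Vec using (Vec; lookup)
open import Data.Product using (Σ; ∃; ∃-syntax; _×_; _,_)
open import Relation.Binary.PropositionalEquality using (_≡_; _≢_)
open import Relation.Nullary using (¬_)

record Graph (n : ℕ) : Set where
  field
    adj    : Fin n → Fin n → Bool
    sym    : ∀ u v → adj u v ≡ adj v u
    irrefl : ∀ v → adj v v ≡ false

module _ {n : ℕ} (G : Graph n) where
  open Graph G

  Adj : Fin n → Fin n → Set
  Adj u v = T (adj u v)

  neighbours : Fin n → List (Fin n)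
  neighbours v = filter (λ w → T? (adj v w)) (allFin n)

  deg : Fin n → ℕ
  deg v = length (neighbours v)

  Subcubic : Set
  Subcubic = ∀ v → deg v ≤ 3

  Saturated : ℕ → Set
  Saturated k = ∀ v → deg v ≡ 3 →
    length (filter (λ w → deg w Data.Nat.≟ 3) (neighbours v)) ≤ k

  data Walk : ℕ → Fin n → Fin n → Set where
    here  : ∀ {u} → Walk zero u u
    there : ∀ {k u w v} → Adj u w → Walk k w v → Walk (suc k) u v

  -- dist_G(u,v) ≤ s  (false when u,v are in different components: dist = ∞)
  DistLe : Fin n → Fin n → ℕ → Set
  DistLe u v s = ∃[ k ] (k ≤ s × Walk k u v)

  IsPackingColouring : ∀ {k} → Vec ℕ k → (Fin n → Fin k) → Set
  IsPackingColouring S c =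
    ∀ u v → u ≢ v → c u ≡ c v → ¬ DistLe u v (lookup S (c u))

  PackingColourable : ∀ {k} → Vec ℕ k → Set
  PackingColourable {k} S = Σ (Fin n → Fin k) (IsPackingColouring S)

  lastFrom : Fin n → List (Fin n) → Fin n
  lastFrom x []       = x
  lastFrom x (y ∷ ys) = lastFrom y ys

  CycleThrough : Fin n → ℕ → Set
  CycleThrough v k = Σ (List (Fin n)) λ xs →
    length (v ∷ xs) ≡ k × 3 ≤ k × Unique (v ∷ xs) ×
    Linked Adj (v ∷ xs) × Adj (lastFrom v xs) v

  LocalGirth : Fin n → ℕ → Set
  LocalGirth v k = CycleThrough v k × (∀ j → j < k → ¬ CycleThrough v j)

  -- g₃(G) = g (finite), where g₃(G) = max { g(v) : d(v) = 3 }: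
  -- the maximum is attained at some degree-3 vertex, and every degree-3
  -- vertex has finite local girth at most g
  G3Is : ℕ → Set
  G3Is g = (∃[ v ] (deg v ≡ 3 × LocalGirth v g))
         × (∀ v → deg v ≡ 3 → ∃[ j ] (j ≤ g × LocalGirth v j))

{-# OPTIONS --safe #-}
module Submission where

-- A vertex with at most four vertices within distance 2 can be coloured last.
-- This disposes of leaves, of degree-2 vertices lying on a triangle, and of paths of
-- three degree-2 vertices (delete all three, recolour the outer two and then the
-- middle one); in each case deletion leaves the square of the rest unchanged.
--
-- What survives consists of disjoint triangles of degree-3 vertices, each vertex a
-- of which leads by an arm a - p - d or a - p - q - d (p, q of degree 2) to another
-- degree-3 vertex d. Colour the degree-3 vertices with four colours; each triangle then
-- has one missing colour. Give p the fifth colour on a short arm, and on a long arm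
-- give the fifth colour to one of p, q and, to the other, the colour missing at its own
-- triangle. This works if the ends of a short arm differ, and if on a long arm the
-- missing colour used differs from the colour of the far end. Seen from one triangle
-- this forbids, on each of its three arms, one colour for the vertex or one value for the
-- missing colour, which a permutation of four colours can always respect; hence the
-- triangles can be coloured greedily.

open import Defs
open import Data.Bool using (Bool; T; _∧_)
open import Data.Bool.Properties using (T?; T-∧; ∧-comm)
open import Data.Fin as Fin using (Fin; zero; suc; inject₁; fromℕ)
open import Data.Fin.Properties
  using (_≟_; _<?_; <-cmp; <-asym; all?; any?; ¬∀⟶∃¬; inject₁-injective; fromℕ≢inject₁)
open import Data.List using (List; []; _∷_; length; filter; allFin; _++_; map)
open import Data.List.Membership.Propositional using (_∈_; _∉_)
open import Data.List.Membership.Propositional.Properties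
  using (∈-map⁺; ∈-filter⁺; ∈-filter⁻; ∈-allFin; ∈-++⁺ˡ; ∈-++⁺ʳ)
open import Data.List.Properties using (filter-notAll; length-map; length-++; length-tabulate)
open import Data.List.Relation.Binary.Subset.Propositional using (_⊆_)
open import Data.List.Relation.Unary.All using ([]; _∷_)
import Data.List.Relation.Unary.All as All
open import Data.List.Relation.Unary.All.Properties using (¬Any⇒All¬)
open import Data.List.Relation.Unary.AllPairs using ([]; _∷_)
open import Data.List.Relation.Unary.Any using (here; there)
import Data.List.Relation.Unary.Any as Any
open import Data.List.Relation.Unary.Linked using ([-]; _∷_)
open import Data.List.Relation.Unary.Unique.Propositional using (Unique)
import Data.List.Relation.Unary.Unique.Propositional.Properties as Unique
open import Data.Nat using (zero; suc; _≤_; _<_; z≤n; s≤s; s≤s⁻¹)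
open import Data.Nat.Induction using (<-wellFounded)
open import Data.Nat.Properties
  using (≤-refl; ≤-trans; ≤-reflexive; ≤-antisym; n≮n; +-mono-≤)
open import Data.Product using (∃; ∃₂; _×_; _,_; proj₁; proj₂)
open import Data.Sum using (_⊎_; inj₁; inj₂; [_,_]′)
open import Data.Unit using (⊤; tt)
open import Data.Vec using (_∷_; [])
open import Data.Vec.Properties using (lookup-replicate)
open import Function using (_∘_; id; case_of_; Equivalence)
open import Induction.WellFounded using (Acc; acc)
open import Relation.Binary.Definitions using (tri<; tri≈; tri>)
open import Relation.Binary.PropositionalEquality
  using (_≡_; _≢_; refl; sym; trans; cong; cong₂; subst; ≢-sym)
open import Relation.Nullary using (¬_; Dec; yes; no; contradiction; ⌊_⌋; ¬?)
open import Relation.Nullary.Decidable using (toWitness; fromWitness; decidable-stable; map′; _×-dec_)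

-- Counting in lists and finite choice.

module _ {A : Set} where

  extract : ∀ {x : A} {xs} → x ∈ xs →
            ∃ λ ys → length xs ≡ suc (length ys) × (∀ {w} → w ∈ xs → w ≢ x → w ∈ ys)
  extract {xs = x ∷ ys} (here refl) = ys , refl , λ where
    (here refl) w≢x → contradiction refl w≢x
    (there w∈)  w≢x → w∈
  extract {xs = y ∷ _} (there x∈) with extract x∈
  ... | ys , eq , keep = y ∷ ys , cong suc eq , λ where
    (here w≡y) w≢x → here w≡y
    (there w∈) w≢x → there (keep w∈ w≢x)

  unique-⊆⇒length≤ : ∀ {xs ys : List A} → Unique xs → xs ⊆ ys → length xs ≤ length ys
  unique-⊆⇒length≤ []         xs⊆ = z≤n
  unique-⊆⇒length≤ (x∉ ∷ uxs) xs⊆ with extract (xs⊆ (here refl))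
  ... | ys , eq , keep = subst (_ ≤_) (sym eq)
    (s≤s (unique-⊆⇒length≤ uxs λ w∈ → keep (xs⊆ (there w∈)) (≢-sym (All.lookup x∉ w∈))))

  three-⊆⇒3≤ : ∀ {x y z : A} {l} → x ≢ y → x ≢ z → y ≢ z → x ∈ l → y ∈ l → z ∈ l → 3 ≤ length l
  three-⊆⇒3≤ {x} {y} {z} x≢y x≢z y≢z x∈ y∈ z∈ =
    unique-⊆⇒length≤ {xs = x ∷ y ∷ z ∷ []} ((x≢y ∷ x≢z ∷ []) ∷ (y≢z ∷ []) ∷ [] ∷ []) λ where
      (here refl)                 → x∈
      (there (here refl))         → y∈
      (there (there (here refl))) → z∈

∃-fresh : ∀ {k} (xs : List (Fin k)) → length xs < k → ∃ λ x → x ∉ xs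
∃-fresh {k} xs xs<k = ¬∀⟶∃¬ k (_∈ xs) (λ x → Any.any? (x ≟_) xs) λ all∈ →
  n≮n k (≤-trans (s≤s (≤-trans (≤-reflexive (sym (length-tabulate id)))
    (unique-⊆⇒length≤ (Unique.allFin⁺ k) (λ {x} _ → all∈ x)))) xs<k)

-- Turns a vertex-by-vertex choice between a reduction and a local description into a single
-- reduction or a description everywhere.
decide-all : ∀ {n} {A B : Fin n → Set} → (∀ v → A v ⊎ B v) → ∃ A ⊎ (∀ v → B v)
decide-all {zero}  d = inj₂ λ ()
decide-all {suc n} d with d zero | decide-all (d ∘ suc)
... | inj₁ a | _            = inj₁ (zero , a)
... | inj₂ _ | inj₁ (v , a) = inj₁ (suc v , a)
... | inj₂ b | inj₂ bs      = inj₂ λ { zero → b ; (suc v) → bs v }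

distinct-pairs : ∀ {R : Fin 3 → Fin 3 → Set} → (∀ {i j} → R i j → R j i) →
                 R zero (suc zero) → R zero (suc (suc zero)) → R (suc zero) (suc (suc zero)) →
                 ∀ {i j} → i ≢ j → R i j
distinct-pairs R-sym r₀₁ r₀₂ r₁₂ {zero}           {zero}           i≢j = contradiction refl i≢j
distinct-pairs R-sym r₀₁ r₀₂ r₁₂ {zero}           {suc zero}       _   = r₀₁
distinct-pairs R-sym r₀₁ r₀₂ r₁₂ {zero}           {suc (suc zero)} _   = r₀₂
distinct-pairs R-sym r₀₁ r₀₂ r₁₂ {suc zero}       {zero}           _   = R-sym r₀₁
distinct-pairs R-sym r₀₁ r₀₂ r₁₂ {suc zero}       {suc zero}       i≢j = contradiction refl i≢j
distinct-pairs R-sym r₀₁ r₀₂ r₁₂ {suc zero}       {suc (suc zero)} _   = r₁₂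
distinct-pairs R-sym r₀₁ r₀₂ r₁₂ {suc (suc zero)} {zero}           _   = R-sym r₀₂
distinct-pairs R-sym r₀₁ r₀₂ r₁₂ {suc (suc zero)} {suc zero}       _   = R-sym r₁₂
distinct-pairs R-sym r₀₁ r₀₂ r₁₂ {suc (suc zero)} {suc (suc zero)} i≢j = contradiction refl i≢j

-- Admissible graphs, partial colourings and reducibility.

record Claw {n} (G : Graph n) (v x y z : Fin n) : Set where
  constructor claw
  field
    v~x : Adj G v x
    v~y : Adj G v y
    v~z : Adj G v z
    x≢y : x ≢ y
    x≢z : x ≢ z
    y≢z : y ≢ z

module _ {n} (G : Graph n) where

  private
    infix 4 _~_

    _~_ : Fin n → Fin n → Set
    _~_ = Adj G

  ~-sym : ∀ {u v} → u ~ v → v ~ u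
  ~-sym {u} {v} = subst T (Graph.sym G u v)

  ~⇒≢ : ∀ {u v} → u ~ v → u ≢ v
  ~⇒≢ {u} u~u refl = subst T (Graph.irrefl G u) u~u

  N⊆ : Fin n → List (Fin n) → Set
  N⊆ v l = ∀ {w} → v ~ w → w ∈ l

  -- Stated by three distinct neighbours instead of a degree equation, so that it passes from a
  -- subgraph to the whole graph; under the degree bound it means degree 3.
  Cubic : Fin n → Set
  Cubic v = ∃₂ λ x y → ∃ (Claw G v x y)

  -- A neighbour outside the claw would give four distinct entries in a list of length at most 3.
  bounded⇒claw-N⊆ : ∀ {v x y z l} → length l ≤ 3 → N⊆ v l → Claw G v x y z → N⊆ v (x ∷ y ∷ z ∷ [])
  bounded⇒claw-N⊆ {v} {x} {y} {z} l≤3 N⊆l (claw a b c x≢y x≢z y≢z) {w} v~w =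
    decidable-stable (Any.any? (w ≟_) (x ∷ y ∷ z ∷ [])) λ w∉ → n≮n 3 (≤-trans
      (unique-⊆⇒length≤ {xs = w ∷ x ∷ y ∷ z ∷ []}
        (¬Any⇒All¬ _ w∉ ∷ (x≢y ∷ x≢z ∷ []) ∷ (y≢z ∷ []) ∷ [] ∷ [])
        λ { (here refl)                         → N⊆l v~w
          ; (there (here refl))                 → N⊆l a
          ; (there (there (here refl)))         → N⊆l b
          ; (there (there (there (here refl)))) → N⊆l c })
      l≤3)

  -- Shaped to survive deletion: `subcubic` bounds the neighbours by a list, the other fields speak
  -- of claws, which deletion can only destroy, and the edge demanded by `triangle` joins leaves of
  -- a surviving claw.
  record Admissible : Set where
    field
      subcubic  : ∀ v → ∃ λ l → length l ≤ 3 × N⊆ v l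
      triangle  : ∀ {v x y z} → Claw G v x y z → x ~ y ⊎ x ~ z ⊎ y ~ z
      saturated : ∀ {v x y z} → Claw G v x y z → Cubic x → Cubic y → ¬ Cubic z

  -- Distance at most 2. A vertex with a neighbour is near itself by a walk out and back, hence the
  -- separate `u ≢ v` in colourings.
  Near : Fin n → Fin n → Set
  Near u v = u ~ v ⊎ ∃ λ w → u ~ w × w ~ v

  -- The values of `c` on `U` are ignored, but vertices of `U` still count as midpoints of paths.
  PartialColouring : List (Fin n) → (Fin n → Fin 5) → Set
  PartialColouring U c = ∀ {u v} → u ∉ U → v ∉ U → u ≢ v → Near u v → c u ≢ c v

  Near-sym : ∀ {u v} → Near u v → Near v u
  Near-sym (inj₁ e)           = inj₁ (~-sym e)
  Near-sym (inj₂ (w , e , f)) = inj₂ (w , ~-sym f , ~-sym e)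

  -- Four vertices block at most four of the five colours; only those already coloured have to be
  -- listed.
  extend : ∀ {U c v} l → PartialColouring (v ∷ U) c → length l ≤ 4 →
           (∀ {u} → u ∉ v ∷ U → Near v u → u ∈ l) → ∃ (PartialColouring U)
  extend {U} {c} {v} l pc l≤4 near∈l with ∃-fresh (map c l) (s≤s (subst (_≤ 4) (sym (length-map c l)) l≤4))
  ... | x , x∉ = c′ , proper
    where
    c′ : Fin n → Fin 5
    c′ u with u ≟ v
    ... | yes _ = x
    ... | no  _ = c u

    avoid : ∀ {u} → u ≢ v → u ∉ U → Near v u → x ≢ c u
    avoid u≢v u∉ nr refl = x∉ (∈-map⁺ c (near∈l (λ { (here u≡v) → u≢v u≡v ; (there u∈) → u∉ u∈ }) nr))

    proper : PartialColouring U c′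
    proper {a} {b} a∉ b∉ a≢b nr with a ≟ v | b ≟ v
    ... | yes refl | yes refl = contradiction refl a≢b
    ... | yes refl | no b≢v   = avoid b≢v b∉ nr
    ... | no a≢v   | yes refl = ≢-sym (avoid a≢v a∉ (Near-sym nr))
    ... | no a≢v   | no b≢v   = pc (λ { (here e) → a≢v e ; (there e) → a∉ e })
                                   (λ { (here e) → b≢v e ; (there e) → b∉ e }) a≢b nr

  -- `square-kept` makes a colouring of the remaining graph a partial colouring of this one; the
  -- non-isolated `witness` makes the induction measure drop.
  record Reducible : Set where
    field
      deleted      : List (Fin n)
      {witness}    : Fin n
      {neighbour}  : Fin n
      witness∈     : witness ∈ deleted
      nontrivial   : witness ~ neighbour
      square-kept  : ∀ {t u w} → t ∈ deleted → u ∉ deleted → w ∉ deleted →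
                     u ~ t → t ~ w → u ≢ w → u ~ w
      extends      : ∀ {c} → PartialColouring deleted c → ∃ (PartialColouring [])

-- Deletion of vertices and the induction.

module _ {n} (G : Graph n) (U : List (Fin n)) where

  private
    kept? : ∀ v → Dec (v ∉ U)
    kept? v = ¬? (Any.any? (v ≟_) U)

    kept : Fin n → Bool
    kept v = ⌊ kept? v ⌋

  -- The vertex set stays `Fin n`, and the vertices of `U` become isolated; progress is therefore
  -- measured on non-isolated vertices.
  delete : Graph n
  delete = record
    { adj    = λ u v → Graph.adj G u v ∧ (kept u ∧ kept v)
    ; sym    = λ u v → cong₂ _∧_ (Graph.sym G u v) (∧-comm (kept u) (kept v))
    ; irrefl = λ v → cong (_∧ (kept v ∧ kept v)) (Graph.irrefl G v)
    }

  delete⁻ : ∀ {u v} → Adj delete u v → Adj G u v × u ∉ U × v ∉ U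
  delete⁻ {u} {v} e =
    let e₁ , e₂ = Equivalence.to (T-∧ {Graph.adj G u v}) e
        e₃ , e₄ = Equivalence.to (T-∧ {kept u}) e₂
    in e₁ , toWitness {a? = kept? u} e₃ , toWitness {a? = kept? v} e₄

  delete⁺ : ∀ {u v} → Adj G u v → u ∉ U → v ∉ U → Adj delete u v
  delete⁺ {u} {v} e u∉ v∉ = Equivalence.from T-∧
    (e , Equivalence.from T-∧ (fromWitness {a? = kept? u} u∉ , fromWitness {a? = kept? v} v∉))

  delete-~ : ∀ {u v} → Adj delete u v → Adj G u v
  delete-~ = proj₁ ∘ delete⁻

  delete-claw : ∀ {v x y z} → Claw delete v x y z → Claw G v x y z
  delete-claw (claw a b c d e f) = claw (delete-~ a) (delete-~ b) (delete-~ c) d e f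

  delete-cubic : ∀ {v} → Cubic delete v → Cubic G v
  delete-cubic (x , y , z , cl) = x , y , z , delete-claw cl

  delete-admissible : Admissible G → Admissible delete
  delete-admissible ad = record
    { subcubic  = λ v → let l , l≤3 , N⊆l = subcubic v in l , l≤3 , λ e → N⊆l (delete-~ e)
    ; triangle  = λ cl@(claw a b c _ _ _) →
        let x∉ = proj₂ (proj₂ (delete⁻ a))
            y∉ = proj₂ (proj₂ (delete⁻ b))
            z∉ = proj₂ (proj₂ (delete⁻ c))
        in case triangle (delete-claw cl) of λ where
             (inj₁ e)        → inj₁ (delete⁺ e x∉ y∉)
             (inj₂ (inj₁ e)) → inj₂ (inj₁ (delete⁺ e x∉ z∉))
             (inj₂ (inj₂ e)) → inj₂ (inj₂ (delete⁺ e y∉ z∉))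
    ; saturated = λ cl cx cy cz →
        saturated (delete-claw cl) (delete-cubic cx) (delete-cubic cy) (delete-cubic cz)
    }
    where open Admissible ad

Colourable : ∀ {n} → Graph n → Set
Colourable G = ∃ (PartialColouring G [])

delete-colouring : ∀ {n} {G : Graph n} (r : Reducible G) →
                   Colourable (delete G (Reducible.deleted r)) → Colourable G
delete-colouring {n} {G} r (c , proper) = extends λ {u} {v} u∉ v∉ u≢v nr →
  proper (λ ()) (λ ()) u≢v (near u∉ v∉ u≢v nr)
  where
  open Reducible r
  near : ∀ {u v} → u ∉ deleted → v ∉ deleted → u ≢ v → Near G u v → Near (delete G deleted) u v
  near u∉ v∉ u≢v (inj₁ e) = inj₁ (delete⁺ G deleted e u∉ v∉)
  near u∉ v∉ u≢v (inj₂ (w , e , f)) with Any.any? (w ≟_) deleted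
  -- A path through a deleted midpoint is replaced by an edge.
  ... | yes w∈ = inj₁ (delete⁺ G deleted (square-kept w∈ u∉ v∉ e f u≢v) u∉ v∉)
  ... | no  w∉ = inj₂ (w , delete⁺ G deleted e u∉ w∉ , delete⁺ G deleted f w∉ v∉)

reduce : ∀ {n} → (∀ (G : Graph n) → Admissible G → Reducible G ⊎ Colourable G) →
         ∀ (G : Graph n) → Admissible G → Colourable G
reduce {n} step G ad = go (allFin n) (<-wellFounded _) G ad (λ _ → ∈-allFin _)
  where
  -- L contains every vertex that still has a neighbour; its length is the measure.
  go : ∀ L → Acc _<_ (length L) → ∀ G → Admissible G →
       (∀ {u v} → Adj G u v → u ∈ L) → Colourable G
  go L (acc rec) G ad L⊇ with step G ad
  ... | inj₂ col = col
  ... | inj₁ r   = delete-colouring r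
    -- `witness` has a neighbour, so it lies in `L`, and filtering drops it.
    (go (filter kept? L) (rec (filter-notAll kept? L (Any.map (λ { refl w∉ → w∉ witness∈ }) (L⊇ nontrivial))))
        (delete G deleted) (delete-admissible G deleted ad)
        λ e → let e′ , u∉ , _ = delete⁻ G deleted e in ∈-filter⁺ kept? (L⊇ e′) u∉)
    where
    open Reducible r
    kept? : ∀ v → Dec (v ∉ deleted)
    kept? v = ¬? (Any.any? (v ≟_) deleted)

-- From local girth and saturation to admissibility.

module _ {n} (G : Graph n) (sub : Subcubic G) (sat : Saturated G 2) (g₃ : G3Is G 3) where

  private
    nb⁺ : ∀ {v w} → Adj G v w → w ∈ neighbours G v
    nb⁺ {v} {w} e = ∈-filter⁺ (λ w → T? (Graph.adj G v w)) (∈-allFin w) e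

    nb⁻ : ∀ {v w} → w ∈ neighbours G v → Adj G v w
    nb⁻ {v} = proj₂ ∘ ∈-filter⁻ (λ w → T? (Graph.adj G v w)) {xs = allFin n}

    claw-N⊆ : ∀ {v x y z} → Claw G v x y z → N⊆ G v (x ∷ y ∷ z ∷ [])
    claw-N⊆ {v} = bounded⇒claw-N⊆ G (sub v) nb⁺

    cubic⇒deg≡3 : ∀ {v} → Cubic G v → deg G v ≡ 3
    cubic⇒deg≡3 (_ , _ , _ , claw a b c d e f) =
      ≤-antisym (sub _) (three-⊆⇒3≤ d e f (nb⁺ a) (nb⁺ b) (nb⁺ c))

  hypotheses⇒admissible : Admissible G
  hypotheses⇒admissible = record
    { subcubic  = λ v → neighbours G v , sub v , nb⁺
    ; triangle  = triangle
    ; saturated = λ {v} cl@(claw a b c x≢y x≢z y≢z) cx cy cz →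
        n≮n 2 (≤-trans (three-⊆⇒3≤ x≢y x≢z y≢z (cub a cx) (cub b cy) (cub c cz))
                       (sat v (cubic⇒deg≡3 (_ , _ , _ , cl))))
    }
    where
    cub : ∀ {v w} → Adj G v w → Cubic G w → w ∈ filter (λ w → deg G w Data.Nat.≟ 3) (neighbours G v)
    cub e cw = ∈-filter⁺ _ (nb⁺ e) (cubic⇒deg≡3 cw)

    triangle : ∀ {v x y z} → Claw G v x y z → Adj G x y ⊎ Adj G x z ⊎ Adj G y z
    triangle {v} cl with proj₂ g₃ v (cubic⇒deg≡3 (_ , _ , _ , cl))
    ... | _ , j≤3 , (l , len , 3≤j , _ , path , close) , _ with l | ≤-antisym j≤3 3≤j | len | path | close
    -- The cycle length is at most and at least 3, so the cycle is `v`, `p`, `q`, and `p`, `q` are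
    -- leaves of the claw.
    ... | p ∷ q ∷ [] | refl | refl | v~p ∷ p~q ∷ [-] | q~v =
      pair (claw-N⊆ cl v~p) (claw-N⊆ cl (~-sym G q~v))
      where
      pair : ∀ {x y z} → p ∈ x ∷ y ∷ z ∷ [] → q ∈ x ∷ y ∷ z ∷ [] → Adj G x y ⊎ Adj G x z ⊎ Adj G y z
      pair (here refl)                 (here refl)                 = contradiction refl (~⇒≢ G p~q)
      pair (here refl)                 (there (here refl))         = inj₁ p~q
      pair (here refl)                 (there (there (here refl))) = inj₂ (inj₁ p~q)
      pair (there (here refl))         (here refl)                 = inj₁ (~-sym G p~q)
      pair (there (here refl))         (there (here refl))         = contradiction refl (~⇒≢ G p~q)
      pair (there (here refl))         (there (there (here refl))) = inj₂ (inj₂ p~q)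
      pair (there (there (here refl))) (here refl)                 = inj₂ (inj₁ (~-sym G p~q))
      pair (there (there (here refl))) (there (here refl))         = inj₂ (inj₂ (~-sym G p~q))
      pair (there (there (here refl))) (there (there (here refl))) = contradiction refl (~⇒≢ G p~q)

-- Reducible configurations and the surviving local structure.

module Local {n} (G : Graph n) (ad : Admissible G) where
  open Admissible ad

  private
    infix 4 _~_
    _~_ = Adj G

  rest₁ : ∀ {v x} → v ~ x → ∃ λ l → length l ≤ 2 × (∀ {w} → v ~ w → w ≢ x → w ∈ l)
  rest₁ {v} v~x with subcubic v
  ... | l , l≤3 , N⊆l with extract (N⊆l v~x)
  ... | l′ , eq , keep = l′ , s≤s⁻¹ (subst (_≤ 3) eq l≤3) , keep ∘ N⊆l

  rest₂ : ∀ {v x y} → v ~ x → v ~ y → x ≢ y →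
          ∃ λ l → length l ≤ 1 × (∀ {w} → v ~ w → w ≢ x → w ≢ y → w ∈ l)
  rest₂ v~x v~y x≢y with rest₁ v~x
  ... | l , l≤2 , ∈l with extract (∈l v~y (≢-sym x≢y))
  ... | l′ , eq , keep = l′ , s≤s⁻¹ (subst (_≤ 2) eq l≤2) , λ v~w w≢x → keep (∈l v~w w≢x)

  record Two (v x y : Fin n) : Set where
    constructor mkTwo
    field
      v~x  : v ~ x
      v~y  : v ~ y
      x≢y  : x ≢ y
      only : ∀ {w} → v ~ w → w ≡ x ⊎ w ≡ y

  Two-swap : ∀ {v x y} → Two v x y → Two v y x
  Two-swap (mkTwo e f g o) = mkTwo f e (≢-sym g) ([ inj₂ , inj₁ ]′ ∘ o)

  Two-from : ∀ {v x y a} → Two v x y → v ~ a → ∃ λ b → Two v a b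
  Two-from t@(mkTwo _ _ _ o) v~a with o v~a
  ... | inj₁ refl = _ , t
  ... | inj₂ refl = _ , Two-swap t

  Two⇒¬Cubic : ∀ {v x y} → Two v x y → ¬ Cubic G v
  Two⇒¬Cubic {x = x} {y} (mkTwo _ _ _ o) (_ , _ , _ , claw a b c d e f) =
    n≮n 2 (three-⊆⇒3≤ d e f (mem a) (mem b) (mem c))
    where
    mem : ∀ {w} → _ ~ w → w ∈ x ∷ y ∷ []
    mem e with o e
    ... | inj₁ refl = here refl
    ... | inj₂ refl = there (here refl)

  data Neighbours (v : Fin n) : Set where
    none  : (∀ {w} → ¬ v ~ w) → Neighbours v
    one   : ∀ {x} → v ~ x → (∀ {w} → v ~ w → w ≡ x) → Neighbours v
    two   : ∀ {x y} → Two v x y → Neighbours v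
    three : Cubic G v → Neighbours v

  neighbours-view : ∀ v → Neighbours v
  neighbours-view v = go (neighbours G v)
    (Unique.filter⁺ N? (Unique.allFin⁺ n))
    (λ {w} → ∈-filter⁺ N? (∈-allFin w))
    (proj₂ ∘ ∈-filter⁻ N? {xs = allFin n})
    where
    N? = λ w → T? (Graph.adj G v w)

    go : ∀ l → Unique l → (∀ {w} → v ~ w → w ∈ l) → (∀ {w} → w ∈ l → v ~ w) → Neighbours v
    go []              _                                  ⁺ ⁻ = none λ e → case ⁺ e of λ ()
    go (x ∷ [])        _                                  ⁺ ⁻ =
      one (⁻ (here refl)) λ e → case ⁺ e of λ { (here eq) → eq }
    go (x ∷ y ∷ [])    ((x≢y ∷ _) ∷ _)                    ⁺ ⁻ =
      two (mkTwo (⁻ (here refl)) (⁻ (there (here refl))) x≢y λ e →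
        case ⁺ e of λ { (here eq) → inj₁ eq ; (there (here eq)) → inj₂ eq })
    go (x ∷ y ∷ z ∷ _) ((x≢y ∷ x≢z ∷ _) ∷ (y≢z ∷ _) ∷ _) ⁺ ⁻ =
      three (x , y , z , claw (⁻ (here refl)) (⁻ (there (here refl))) (⁻ (there (there (here refl)))) x≢y x≢z y≢z)

  -- Near the leaf lie only `x` and at most two further neighbours of `x`.
  leaf-reducible : ∀ {v x} → v ~ x → (∀ {w} → v ~ w → w ≡ x) → Reducible G
  leaf-reducible {v} {x} v~x only with rest₁ (~-sym G v~x)
  ... | l , l≤2 , ∈l = record
    { deleted     = v ∷ []
    ; witness∈    = here refl
    ; nontrivial  = v~x
    ; square-kept = λ where
        (here refl) _ _ u~v v~w u≢w → contradiction (trans (only (~-sym G u~v)) (sym (only v~w))) u≢w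
    ; extends     = λ pc → extend G (x ∷ l) pc (≤-trans (s≤s l≤2) (s≤s (s≤s (s≤s z≤n)))) λ where
        u∉ (inj₁ v~u)             → here (only v~u)
        u∉ (inj₂ (w , v~w , w~u)) → there (∈l (subst (_~ _) (only v~w) w~u) (u∉ ∘ here))
    }

  -- Each of `x`, `y` has at most one neighbour off the triangle, so at most four vertices are near
  -- `v`; the edge `x ~ y` replaces the path through `v`.
  apex-reducible : ∀ {v x y} → Two v x y → x ~ y → Reducible G
  apex-reducible {v} {x} {y} (mkTwo v~x v~y x≢y only) x~y
    with rest₂ (~-sym G v~x) x~y (~⇒≢ G v~y) | rest₂ (~-sym G v~y) (~-sym G x~y) (~⇒≢ G v~x)
  ... | lx , lx≤1 , ∈lx | ly , ly≤1 , ∈ly = record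
    { deleted     = v ∷ []
    ; witness∈    = here refl
    ; nontrivial  = v~x
    ; square-kept = λ where
        (here refl) _ _ u~v v~w u≢w → kept u≢w (only (~-sym G u~v)) (only v~w)
    ; extends     = λ pc → extend G (x ∷ y ∷ lx ++ ly) pc
        (s≤s (s≤s (subst (_≤ 2) (sym (length-++ lx)) (+-mono-≤ lx≤1 ly≤1)))) near
    }
    where
    kept : ∀ {u w} → u ≢ w → u ≡ x ⊎ u ≡ y → w ≡ x ⊎ w ≡ y → u ~ w
    kept u≢w (inj₁ refl) (inj₁ refl) = contradiction refl u≢w
    kept u≢w (inj₁ refl) (inj₂ refl) = x~y
    kept u≢w (inj₂ refl) (inj₁ refl) = ~-sym G x~y
    kept u≢w (inj₂ refl) (inj₂ refl) = contradiction refl u≢w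

    near : ∀ {u} → u ∉ v ∷ [] → Near G v u → u ∈ x ∷ y ∷ lx ++ ly
    near {u} u∉ nr with u ≟ x | u ≟ y
    ... | yes u≡x | _       = here u≡x
    ... | no _    | yes u≡y = there (here u≡y)
    ... | no u≢x  | no u≢y  with nr
    ...   | inj₁ v~u = contradiction (only v~u) [ u≢x , u≢y ]′
    ...   | inj₂ (w , v~w , w~u) with only v~w
    ...     | inj₁ refl = there (there (∈-++⁺ˡ (∈lx w~u (u∉ ∘ here) u≢y)))
    ...     | inj₂ refl = there (there (∈-++⁺ʳ lx (∈ly w~u (u∉ ∘ here) u≢x)))

  -- No deleted vertex has two distinct surviving neighbours, so the square is kept. Recolouring
  -- follows the order of `deleted`: `p₁` sees at most three coloured vertices, then `p₃` at most
  -- four including `p₁`, and finally `p₂` only `p₁`, `p₃`, `p₀`, `p₄`.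
  path-reducible : ∀ {p₀ p₁ p₂ p₃ p₄} → Two p₁ p₂ p₀ → Two p₂ p₁ p₃ → Two p₃ p₂ p₄ → Reducible G
  path-reducible {p₀} {p₁} {p₂} {p₃} {p₄}
    (mkTwo _ p₁~p₀ _ only₁) (mkTwo p₂~p₁ p₂~p₃ _ only₂) (mkTwo _ p₃~p₄ _ only₃)
    with rest₁ (~-sym G p₁~p₀) | rest₁ (~-sym G p₃~p₄)
  ... | l₀ , l₀≤2 , ∈l₀ | l₄ , l₄≤2 , ∈l₄ = record
    { deleted     = p₁ ∷ p₃ ∷ p₂ ∷ []
    ; witness∈    = here refl
    ; nontrivial  = p₁~p₀
    ; square-kept = kept
    ; extends     = λ pc →
        let _ , pc₁ = extend G (p₀ ∷ l₀) pc (≤-trans (s≤s l₀≤2) (s≤s (s≤s (s≤s z≤n)))) near₁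
            _ , pc₂ = extend G (p₄ ∷ p₁ ∷ l₄) pc₁ (s≤s (s≤s l₄≤2)) near₃
        in extend G (p₁ ∷ p₃ ∷ p₀ ∷ p₄ ∷ []) pc₂ ≤-refl near₂
    }
    where
    kept : ∀ {t u w} → t ∈ p₁ ∷ p₃ ∷ p₂ ∷ [] → u ∉ p₁ ∷ p₃ ∷ p₂ ∷ [] → w ∉ p₁ ∷ p₃ ∷ p₂ ∷ [] →
           u ~ t → t ~ w → u ≢ w → u ~ w
    kept (here refl) u∉ w∉ u~t t~w u≢w with only₁ (~-sym G u~t) | only₁ t~w
    ... | inj₁ refl | _         = contradiction (there (there (here refl))) u∉
    ... | inj₂ _    | inj₁ refl = contradiction (there (there (here refl))) w∉
    ... | inj₂ refl | inj₂ refl = contradiction refl u≢w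
    kept (there (here refl)) u∉ w∉ u~t t~w u≢w with only₃ (~-sym G u~t) | only₃ t~w
    ... | inj₁ refl | _         = contradiction (there (there (here refl))) u∉
    ... | inj₂ _    | inj₁ refl = contradiction (there (there (here refl))) w∉
    ... | inj₂ refl | inj₂ refl = contradiction refl u≢w
    kept (there (there (here refl))) u∉ w∉ u~t t~w u≢w with only₂ (~-sym G u~t)
    ... | inj₁ refl = contradiction (here refl) u∉
    ... | inj₂ refl = contradiction (there (here refl)) u∉

    near₁ : ∀ {u} → u ∉ p₁ ∷ p₃ ∷ p₂ ∷ [] → Near G p₁ u → u ∈ p₀ ∷ l₀
    near₁ u∉ (inj₁ p₁~u) with only₁ p₁~u
    ... | inj₁ refl = contradiction (there (there (here refl))) u∉
    ... | inj₂ u≡p₀ = here u≡p₀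
    near₁ u∉ (inj₂ (w , p₁~w , w~u)) with only₁ p₁~w
    ... | inj₂ refl = there (∈l₀ w~u (u∉ ∘ here))
    ... | inj₁ refl with only₂ w~u
    ...   | inj₁ refl = contradiction (here refl) u∉
    ...   | inj₂ refl = contradiction (there (here refl)) u∉

    near₃ : ∀ {u} → u ∉ p₃ ∷ p₂ ∷ [] → Near G p₃ u → u ∈ p₄ ∷ p₁ ∷ l₄
    near₃ u∉ (inj₁ p₃~u) with only₃ p₃~u
    ... | inj₁ refl = contradiction (there (here refl)) u∉
    ... | inj₂ u≡p₄ = here u≡p₄
    near₃ u∉ (inj₂ (w , p₃~w , w~u)) with only₃ p₃~w
    ... | inj₂ refl = there (there (∈l₄ w~u (u∉ ∘ here)))
    ... | inj₁ refl with only₂ w~u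
    ...   | inj₁ u≡p₁ = there (here u≡p₁)
    ...   | inj₂ refl = contradiction (here refl) u∉

    near₂ : ∀ {u} → u ∉ p₂ ∷ [] → Near G p₂ u → u ∈ p₁ ∷ p₃ ∷ p₀ ∷ p₄ ∷ []
    near₂ u∉ (inj₁ p₂~u) with only₂ p₂~u
    ... | inj₁ u≡p₁ = here u≡p₁
    ... | inj₂ u≡p₃ = there (here u≡p₃)
    near₂ u∉ (inj₂ (w , p₂~w , w~u)) with only₂ p₂~w
    near₂ u∉ (inj₂ (w , p₂~w , w~u)) | inj₁ refl with only₁ w~u
    ... | inj₁ refl = contradiction (here refl) u∉
    ... | inj₂ u≡p₀ = there (there (here u≡p₀))
    near₂ u∉ (inj₂ (w , p₂~w , w~u)) | inj₂ refl with only₃ w~u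
    ... | inj₁ refl = contradiction (here refl) u∉
    ... | inj₂ u≡p₄ = there (there (there (here u≡p₄)))

  record Hub (v b c p : Fin n) : Set where
    constructor mkHub
    field
      claw-v  : Claw G v b c p
      b~c     : b ~ c
      cubic-b : Cubic G b
      cubic-c : Cubic G c
      ¬cubic-p : ¬ Cubic G p

  -- In `link`, the other neighbour `q` has degree 3 or leads on to some `d`, whose own degree is
  -- settled only once every vertex has a core.
  data Core (v : Fin n) : Set where
    isolated : (∀ {w} → ¬ v ~ w) → Core v
    link     : ∀ {a q} → Two v a q → Cubic G a → Cubic G q ⊎ (∃ λ d → Two q v d) → Core v
    hub      : ∀ {b c p} → Hub v b c p → Core v

  private
    end : ∀ {v x} → v ~ x → Reducible G ⊎ (Cubic G x ⊎ ∃ λ d → Two x v d)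
    end {v} {x} v~x with neighbours-view x
    ... | none ¬e  = contradiction (~-sym G v~x) ¬e
    ... | one e o  = inj₁ (leaf-reducible e o)
    ... | two t    = inj₂ (inj₂ (Two-from t (~-sym G v~x)))
    ... | three cu = inj₂ (inj₁ cu)

    -- If `b` had degree 2, its neighbours would be the adjacent vertices `v` and `c`.
    triangle-end : ∀ {v b c} → v ~ b → v ~ c → b ~ c → Reducible G ⊎ Cubic G b
    triangle-end v~b v~c b~c with end v~b
    ... | inj₁ r                = inj₁ r
    ... | inj₂ (inj₁ cu)        = inj₂ cu
    ... | inj₂ (inj₂ (d , t@(mkTwo _ _ _ o))) with o b~c
    ...   | inj₁ refl = contradiction refl (~⇒≢ G v~c)
    ...   | inj₂ refl = inj₁ (apex-reducible t v~c)

    hub-or-reducible : ∀ {v b c p} → Claw G v b c p → b ~ c → Reducible G ⊎ Core v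
    hub-or-reducible cl@(claw v~b v~c _ _ _ _) b~c
      with triangle-end v~b v~c b~c | triangle-end v~c v~b (~-sym G b~c)
    ... | inj₁ r  | _       = inj₁ r
    ... | inj₂ _  | inj₁ r  = inj₁ r
    ... | inj₂ cb | inj₂ cc = inj₂ (hub (mkHub cl b~c cb cc (saturated cl cb cc)))

  classify : ∀ v → Reducible G ⊎ Core v
  classify v with neighbours-view v
  ... | none ¬e = inj₂ (isolated ¬e)
  ... | one e o = inj₁ (leaf-reducible e o)
  ... | two t@(mkTwo v~x v~y _ _) with end v~x | end v~y
  ...   | inj₁ r                 | _                      = inj₁ r
  ...   | inj₂ _                 | inj₁ r                 = inj₁ r
  ...   | inj₂ (inj₁ cx)         | inj₂ ey                = inj₂ (link t cx ey)
  ...   | inj₂ ex@(inj₂ _)       | inj₂ (inj₁ cy)         = inj₂ (link (Two-swap t) cy ex)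
  -- Both neighbours have degree 2, so `v` is the middle of three consecutive degree-2 vertices.
  ...   | inj₂ (inj₂ (_ , t₁))   | inj₂ (inj₂ (_ , t₃))   = inj₁ (path-reducible t₁ t t₃)
  classify v | three (x , y , z , cl@(claw a b c d e f)) with triangle cl
  ...   | inj₁ x~y        = hub-or-reducible cl x~y
  ...   | inj₂ (inj₁ x~z) = hub-or-reducible (claw a c b e d (≢-sym f)) x~z
  ...   | inj₂ (inj₂ y~z) = hub-or-reducible (claw b c a f (≢-sym d) (≢-sym e)) y~z

  core-or-reducible : Reducible G ⊎ (∀ v → Core v)
  core-or-reducible = case decide-all classify of λ where
    (inj₁ (_ , r)) → inj₁ r
    (inj₂ core)    → inj₂ core

-- Constrained four-colourings of a single triangle.

-- Sat κ μ τ: the forbidden value concerns either the vertex colour τ or the colour μ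
-- missing at its triangle.
data Constraint : Set where
  own missing : Fin 4 → Constraint

Sat : Constraint → Fin 4 → Fin 4 → Set
Sat (own x)     μ τ = τ ≢ x
Sat (missing x) μ τ = μ ≢ x

-- `μ` and `τ` form a permutation of the four colours. Each constraint excludes 6 of the 24
-- permutations, so three constraints exclude at most 18.
record TriangleColours (κ : Fin 3 → Constraint) : Set where
  field
    μ           : Fin 4
    τ           : Fin 3 → Fin 4
    τ≢μ         : ∀ i → τ i ≢ μ
    τ-injective : ∀ {i j} → i ≢ j → τ i ≢ τ j
    satisfied   : ∀ i → Sat (κ i) μ (τ i)

sat? : ∀ κ μ τ → Dec (Sat κ μ τ)
sat? (own x)     μ τ = ¬? (τ ≟ x)
sat? (missing x) μ τ = ¬? (μ ≟ x)

-- The tests on each colour follow its choice directly, so that the search prunes early.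
Solution : Constraint → Constraint → Constraint → Set
Solution κ₀ κ₁ κ₂ =
  ∃ λ μ → ∃ λ a → Sat κ₀ μ a × a ≢ μ ×
  ∃ λ b → Sat κ₁ μ b × b ≢ μ × a ≢ b ×
  ∃ λ c → Sat κ₂ μ c × c ≢ μ × a ≢ c × b ≢ c

solution? : ∀ κ₀ κ₁ κ₂ → Dec (Solution κ₀ κ₁ κ₂)
solution? κ₀ κ₁ κ₂ =
  any? λ μ → any? λ a → sat? κ₀ μ a ×-dec ¬? (a ≟ μ) ×-dec
  any? λ b → sat? κ₁ μ b ×-dec ¬? (b ≟ μ) ×-dec ¬? (a ≟ b) ×-dec
  any? λ c → sat? κ₂ μ c ×-dec ¬? (c ≟ μ) ×-dec ¬? (a ≟ c) ×-dec ¬? (b ≟ c)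

all-constraints? : ∀ {P : Constraint → Set} → (∀ κ → Dec (P κ)) → Dec (∀ κ → P κ)
all-constraints? P? = map′
  (λ { (f , g) (own x) → f x ; (f , g) (missing x) → g x })
  (λ h → (h ∘ own) , (h ∘ missing))
  (all? (P? ∘ own) ×-dec all? (P? ∘ missing))

-- By exhaustive search; abstract, since unfolding the search on open terms is intractable.
abstract
  solution : ∀ κ₀ κ₁ κ₂ → Solution κ₀ κ₁ κ₂
  solution = toWitness
    {a? = all-constraints? λ κ₀ → all-constraints? λ κ₁ → all-constraints? λ κ₂ → solution? κ₀ κ₁ κ₂} _

triangle-colours : ∀ κ → TriangleColours κ
triangle-colours κ with solution (κ zero) (κ (suc zero)) (κ (suc (suc zero)))
... | μ , a , sa , aμ , b , sb , bμ , ab , c , sc , cμ , ac , bc = record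
  { μ           = μ
  ; τ           = τ
  ; τ≢μ         = λ { zero → aμ ; (suc zero) → bμ ; (suc (suc zero)) → cμ }
  ; τ-injective = distinct-pairs {R = λ i j → τ i ≢ τ j} ≢-sym ab ac bc
  ; satisfied   = λ { zero → sa ; (suc zero) → sb ; (suc (suc zero)) → sc }
  }
  where
  τ : Fin 3 → Fin 4
  τ zero             = a
  τ (suc zero)       = b
  τ (suc (suc zero)) = c

-- Triangles and arms in an irreducible graph.

module Irreducible {n} (G : Graph n) (ad : Admissible G) (core : ∀ v → Local.Core G ad v) where
  open Admissible ad
  open Local G ad

  private
    infix 4 _~_
    _~_ = Adj G

    ~s : ∀ {u v} → u ~ v → v ~ u
    ~s = ~-sym G

    Cu : Fin n → Set
    Cu = Cubic G

  cubic⇒hub : ∀ {v} → Cu v → ∃₂ λ b c → ∃ (Hub v b c)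
  cubic⇒hub {v} cv@(_ , _ , _ , claw e _ _ _ _ _) with core v
  ... | isolated ¬e = contradiction e ¬e
  ... | link t _ _  = contradiction cv (Two⇒¬Cubic t)
  ... | hub h       = _ , _ , _ , h

  cubic-neighbours : ∀ {v x y w} → v ~ x → v ~ y → x ≢ y → Cu x → Cu y → v ~ w → Cu w → w ≡ x ⊎ w ≡ y
  cubic-neighbours {x = x} {y} {w} v~x v~y x≢y cx cy v~w cw with w ≟ x | w ≟ y
  ... | yes w≡x | _       = inj₁ w≡x
  ... | no _    | yes w≡y = inj₂ w≡y
  ... | no w≢x  | no w≢y  =
    contradiction cw (saturated (claw v~x v~y v~w x≢y (≢-sym w≢x) (≢-sym w≢y)) cx cy)

  -- By saturation the degree-3 neighbours of `v` are the two other vertices of its triangle.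
  cubic-neighbours-adjacent : ∀ {v x y} → Cu v → v ~ x → Cu x → v ~ y → Cu y → x ≢ y → x ~ y
  cubic-neighbours-adjacent cv v~x cx v~y cy x≢y with cubic⇒hub cv
  ... | _ , _ , _ , mkHub (claw v~b v~c _ b≢c _ _) b~c cb cc _
    with cubic-neighbours v~b v~c b≢c cb cc v~x cx | cubic-neighbours v~b v~c b≢c cb cc v~y cy
  ... | inj₁ refl | inj₁ refl = contradiction refl x≢y
  ... | inj₁ refl | inj₂ refl = b~c
  ... | inj₂ refl | inj₁ refl = ~s b~c
  ... | inj₂ refl | inj₂ refl = contradiction refl x≢y

  outer-unique : ∀ {v p q} → Cu v → v ~ p → ¬ Cu p → v ~ q → ¬ Cu q → p ≡ q
  outer-unique {v} {p} {q} cv v~p ¬cp v~q ¬cq with cubic⇒hub cv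
  ... | b , c , r , mkHub cl _ cb cc _ = trans (outer v~p ¬cp) (sym (outer v~q ¬cq))
    where
    outer : ∀ {w} → v ~ w → ¬ Cu w → w ≡ r
    outer v~w ¬cw with (let _ , l≤3 , N⊆l = subcubic v in bounded⇒claw-N⊆ G l≤3 N⊆l cl v~w)
    ... | here refl                 = contradiction cb ¬cw
    ... | there (here refl)         = contradiction cc ¬cw
    ... | there (there (here w≡r)) = w≡r

  data Arm (a p : Fin n) : Set where
    short : ∀ {d} → Two p a d → Cu d → Arm a p
    long  : ∀ {q d} → Two p a q → Two q p d → Cu d → Arm a p

  -- The core of `q` must be a `link`; its degree-3 neighbour cannot be `p`, hence is `d`.
  far-end : ∀ {p q a d} → Two p a q → Two q p d → Cu d
  far-end {p} {q} t@(mkTwo _ p~q _ _) t′@(mkTwo q~p q~d _ _) with core q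
  ... | isolated ¬e = contradiction q~p ¬e
  ... | hub h       = contradiction (_ , _ , _ , Hub.claw-v h) (Two⇒¬Cubic t′)
  ... | link (mkTwo q~a _ _ _) ca _ with Two.only t′ q~a
  ...   | inj₁ refl = contradiction ca (Two⇒¬Cubic t)
  ...   | inj₂ refl = ca

  arm : ∀ {a p} → Cu a → a ~ p → ¬ Cu p → Arm a p
  arm {a} {p} ca a~p ¬cp with core p
  ... | isolated ¬e = contradiction (~s a~p) ¬e
  ... | hub h       = contradiction (_ , _ , _ , Hub.claw-v h) ¬cp
  ... | link t@(mkTwo _ _ _ o) ca′ e with o (~s a~p) | e
  -- The `link` at `p` singles out one degree-3 neighbour, which need not be `a`.
  ...   | inj₂ refl | _               = short (Two-swap t) ca′
  ...   | inj₁ refl | inj₁ cq         = short t cq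
  ...   | inj₁ refl | inj₂ (d , t′) = long t t′ (far-end t t′)

  -- Good colourings, built one triangle at a time.

  -- f is the colour of a degree-3 vertex and m the colour missing at its triangle. On a
  -- long arm the smaller of the two middle vertices is the one that will receive m.
  record Good (S : Fin n → Set) (f m : Fin n → Fin 4) : Set where
    field
      own-ok   : ∀ {a} → S a → Cu a → f a ≢ m a
      adj-f    : ∀ {a b} → S a → S b → Cu a → Cu b → a ~ b → f a ≢ f b
      adj-m    : ∀ {a b} → S a → S b → Cu a → Cu b → a ~ b → m a ≡ m b
      short-ok : ∀ {a p d} → S a → S d → Cu a → Cu d → ¬ Cu p → a ≢ d → a ~ p → p ~ d → f a ≢ f d
      long-ok  : ∀ {a p q d} → S a → S d → Cu a → Cu d → ¬ Cu p → ¬ Cu q →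
                 a ~ p → p ~ q → q ~ d → p Fin.< q → m a ≢ f d

  Good-anti : ∀ {S S′ f m} → (∀ {v} → Cu v → S′ v → S v) → Good S f m → Good S′ f m
  Good-anti S′⊆ g = record
    { own-ok   = λ sa ca → own-ok (S′⊆ ca sa) ca
    ; adj-f    = λ sa sb ca cb → adj-f (S′⊆ ca sa) (S′⊆ cb sb) ca cb
    ; adj-m    = λ sa sb ca cb → adj-m (S′⊆ ca sa) (S′⊆ cb sb) ca cb
    ; short-ok = λ sa sd ca cd → short-ok (S′⊆ ca sa) (S′⊆ cd sd) ca cd
    ; long-ok  = λ sa sd ca cd → long-ok (S′⊆ ca sa) (S′⊆ cd sd) ca cd
    }
    where open Good g

  record Triangle : Set where
    field
      t     : Fin 3 → Fin n
      t-adj : ∀ {i j} → i ≢ j → t i ~ t j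
      cubic : ∀ i → Cu (t i)

    -- Saturation allows `t i` only its two partners as degree-3 neighbours; so distinct triangles
    -- are disjoint and no edge joins them.
    closed : ∀ i {w} → Cu w → t i ~ w → ∃ λ j → t j ≡ w
    closed i {w} cw e = pick i e
      where
      via : ∀ i j k → i ≢ j → i ≢ k → j ≢ k → t i ~ w → ∃ λ l → t l ≡ w
      via i j k i≢j i≢k j≢k e with
        cubic-neighbours (t-adj i≢j) (t-adj i≢k) (~⇒≢ G (t-adj j≢k)) (cubic j) (cubic k) e cw
      ... | inj₁ w≡ = j , sym w≡
      ... | inj₂ w≡ = k , sym w≡

      pick : ∀ i → t i ~ w → ∃ λ j → t j ≡ w
      pick zero             = via zero (suc zero) (suc (suc zero)) (λ ()) (λ ()) (λ ())
      pick (suc zero)       = via (suc zero) zero (suc (suc zero)) (λ ()) (λ ()) (λ ())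
      pick (suc (suc zero)) = via (suc (suc zero)) zero (suc zero) (λ ()) (λ ()) (λ ())

  hub-triangle : ∀ {v b c p} → Hub v b c p → Cu v → Triangle
  hub-triangle {v} {b} {c} (mkHub (claw v~b v~c _ _ _ _) b~c cb cc _) cv = record
    { t     = t
    ; t-adj = distinct-pairs {R = λ i j → t i ~ t j} ~s v~b v~c b~c
    ; cubic = λ { zero → cv ; (suc zero) → cb ; (suc (suc zero)) → cc }
    }
    where
    t : Fin 3 → Fin n
    t zero             = v
    t (suc zero)       = b
    t (suc (suc zero)) = c

  module Recolour (T : Triangle) {S : Fin n → Set} {f m : Fin n → Fin 4} (good : Good S f m) where
    open Triangle T

    -- Reads the old colours at the far end `d`. If `d` lies on `T` these are outdated, which is
    -- harmless: arms with both ends on `T` are settled by `τ-injective` and `τ≢μ`.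
    arm-constraint : ∀ {a p} → Arm a p → Constraint
    arm-constraint             (short {d} _ _)      = own (f d)
    arm-constraint {p = p} (long {q} {d} _ _ _) with p <? q
    ... | yes _ = missing (f d)
    ... | no  _ = own (m d)

    -- The arm clauses of `Good` with one end at `a`: in `long-ok→` the smaller middle vertex is
    -- next to `a`, in `long-ok←` it is next to the far end.
    record Compatible (a : Fin n) (μ τ : Fin 4) : Set where
      field
        short-ok  : ∀ {p e} → Cu e → ¬ Cu p → a ≢ e → a ~ p → p ~ e → τ ≢ f e
        long-ok→ : ∀ {p q e} → Cu e → ¬ Cu p → ¬ Cu q → a ~ p → p ~ q → q ~ e → p Fin.< q → μ ≢ f e
        long-ok← : ∀ {p q e} → Cu e → ¬ Cu p → ¬ Cu q → a ~ q → q ~ p → p ~ e → p Fin.< q → m e ≢ τ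

    -- By `outer-unique` every path leaving `a` through a vertex not of degree 3 runs along `α`, so
    -- one constraint covers all clauses.
    compatible : ∀ {a r μ τ} → Cu a → a ~ r → ¬ Cu r → (α : Arm a r) →
                 Sat (arm-constraint α) μ τ → Compatible a μ τ
    compatible {a} {r} {μ} {τ} ca a~r ¬cr (short {d} (mkTwo _ _ _ o) cd) sat = record
      { short-ok  = sh
      ; long-ok→ = lo
      ; long-ok← = λ ce ¬cp ¬cq a~q q~p p~e p<q → lo ce ¬cq ¬cp a~q q~p p~e
      }
      where
      sh : ∀ {p e} → Cu e → ¬ Cu p → a ≢ e → a ~ p → p ~ e → τ ≢ f e
      sh ce ¬cp a≢e a~p p~e with outer-unique ca a~r ¬cr a~p ¬cp
      ... | refl with o p~e
      ...   | inj₁ refl = contradiction refl a≢e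
      ...   | inj₂ refl = sat
      -- Both neighbours of `r` on a short arm have degree 3, so the premises clash and anything
      -- follows.
      lo : ∀ {p q e} {A : Set} → Cu e → ¬ Cu p → ¬ Cu q → a ~ p → p ~ q → q ~ e → A
      lo ce ¬cp ¬cq a~p p~q q~e with outer-unique ca a~r ¬cr a~p ¬cp
      ... | refl with o p~q
      ...   | inj₁ refl = contradiction ca ¬cq
      ...   | inj₂ refl = contradiction cd ¬cq
    compatible {a} {r} {μ} {τ} ca a~r ¬cr (long {q} {d} (mkTwo _ _ _ o) t′@(mkTwo _ _ _ o′) cd) sat = record
      { short-ok  = sh
      ; long-ok→ = λ ce ¬cp ¬cq a~p p~q q~e p<q → right (path ce ¬cp ¬cq a~p p~q q~e) p<q
      ; long-ok← = λ ce ¬cp ¬cq a~q q~p p~e p<q → left (path ce ¬cq ¬cp a~q q~p p~e) p<q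
      }
      where
      sh : ∀ {p e} → Cu e → ¬ Cu p → a ≢ e → a ~ p → p ~ e → τ ≢ f e
      sh ce ¬cp a≢e a~p p~e with outer-unique ca a~r ¬cr a~p ¬cp
      ... | refl with o p~e
      ...   | inj₁ refl = contradiction refl a≢e
      ...   | inj₂ refl = contradiction ce (Two⇒¬Cubic t′)
      path : ∀ {p q′ e} → Cu e → ¬ Cu p → ¬ Cu q′ → a ~ p → p ~ q′ → q′ ~ e → r ≡ p × q ≡ q′ × d ≡ e
      path ce ¬cp ¬cq a~p p~q q~e with outer-unique ca a~r ¬cr a~p ¬cp
      ... | refl with o p~q
      ...   | inj₁ refl = contradiction ca ¬cq
      ...   | inj₂ refl with o′ q~e
      ...     | inj₁ refl = contradiction ce ¬cp
      ...     | inj₂ refl = refl , refl , refl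
      right : ∀ {p q′ e} → r ≡ p × q ≡ q′ × d ≡ e → p Fin.< q′ → μ ≢ f e
      right (refl , refl , refl) r<q with r <? q
      ... | yes _  = sat
      ... | no r≮q = contradiction r<q r≮q
      left : ∀ {p q′ e} → r ≡ p × q ≡ q′ × d ≡ e → q′ Fin.< p → m e ≢ τ
      left (refl , refl , refl) q<r with r <? q
      ... | yes r<q = contradiction q<r (<-asym r<q)
      ... | no _    = ≢-sym sat

    private
      constraint : Fin 3 → Constraint
      constraint i with cubic⇒hub (cubic i)
      ... | _ , _ , _ , mkHub (claw _ _ e _ _ _) _ _ _ ¬cp = arm-constraint (arm (cubic i) e ¬cp)

    open TriangleColours (triangle-colours constraint)

    private
      compat : ∀ i → Compatible (t i) μ (τ i)
      compat i with cubic⇒hub (cubic i) | satisfied i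
      ... | _ , _ , _ , mkHub (claw _ _ e _ _ _) _ _ _ ¬cp | s = compatible (cubic i) e ¬cp (arm (cubic i) e ¬cp) s

      module C i = Compatible (compat i)

      data Position (u : Fin n) : Set where
        at  : ∀ i → t i ≡ u → Position u
        out : (∀ i → t i ≢ u) → Position u

      position : ∀ u → Position u
      position u with any? (λ i → t i ≟ u)
      ... | yes (i , eq) = at i eq
      ... | no  ¬any     = out λ i eq → ¬any (i , eq)

      F M : ∀ {u} → Position u → Fin 4
      F     (at i _)  = τ i
      F {u} (out _)   = f u
      M     (at i _)  = μ
      M {u} (out _)   = m u

      S′ : Fin n → Set
      S′ u = S u ⊎ ∃ λ i → t i ≡ u

      old : ∀ {u} → (∀ i → t i ≢ u) → S′ u → S u
      old ∉T (inj₁ s)        = s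
      old ∉T (inj₂ (i , eq)) = contradiction eq (∉T i)

      open Good good

      own′ : ∀ {a} (x : Position a) → S′ a → Cu a → F x ≢ M x
      own′ (at i _) _ _   = τ≢μ i
      own′ (out o)  sa ca = own-ok (old o sa) ca

      adj-f′ : ∀ {a b} (x : Position a) (y : Position b) → S′ a → S′ b → Cu a → Cu b → a ~ b → F x ≢ F y
      adj-f′ (at i refl) (at j refl) _ _ _ _ e   = τ-injective {i} {j} λ { refl → ~⇒≢ G e refl }
      adj-f′ (at i refl) (out o) _ _ _ cb e      = let j , eq = closed i cb e in contradiction eq (o j)
      adj-f′ (out o) (at i refl) _ _ ca _ e      = let j , eq = closed i ca (~s e) in contradiction eq (o j)
      adj-f′ (out o) (out o′) sa sb              = adj-f (old o sa) (old o′ sb)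

      adj-m′ : ∀ {a b} (x : Position a) (y : Position b) → S′ a → S′ b → Cu a → Cu b → a ~ b → M x ≡ M y
      adj-m′ (at i refl) (at j refl) _ _ _ _ e   = refl
      adj-m′ (at i refl) (out o) _ _ _ cb e      = let j , eq = closed i cb e in contradiction eq (o j)
      adj-m′ (out o) (at i refl) _ _ ca _ e      = let j , eq = closed i ca (~s e) in contradiction eq (o j)
      adj-m′ (out o) (out o′) sa sb              = adj-m (old o sa) (old o′ sb)

      short′ : ∀ {a p d} (x : Position a) (y : Position d) → S′ a → S′ d → Cu a → Cu d → ¬ Cu p →
               a ≢ d → a ~ p → p ~ d → F x ≢ F y
      short′ (at i refl) (at j refl) _ _ _ _ _ a≢d _ _     = τ-injective {i} {j} λ { refl → a≢d refl }
      short′ (at i refl) (out _) _ _ _ cd ¬cp a≢d e e′     = C.short-ok i cd ¬cp a≢d e e′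
      short′ (out _) (at i refl) _ _ ca _ ¬cp a≢d e e′     =
        ≢-sym (C.short-ok i ca ¬cp (≢-sym a≢d) (~s e′) (~s e))
      short′ (out o) (out o′) sa sd                        = short-ok (old o sa) (old o′ sd)

      long′ : ∀ {a p q d} (x : Position a) (y : Position d) → S′ a → S′ d → Cu a → Cu d → ¬ Cu p → ¬ Cu q →
              a ~ p → p ~ q → q ~ d → p Fin.< q → M x ≢ F y
      -- Both ends lie on `T`, where no vertex has the missing colour `μ`.
      long′ (at i _) (at j _) _ _ _ _ _ _ _ _ _ _                = ≢-sym (τ≢μ j)
      long′ (at i refl) (out _) _ _ _ cd ¬cp ¬cq e₁ e₂ e₃ p<q   = C.long-ok→ i cd ¬cp ¬cq e₁ e₂ e₃ p<q
      long′ (out _) (at i refl) _ _ ca _ ¬cp ¬cq e₁ e₂ e₃ p<q   =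
        C.long-ok← i ca ¬cp ¬cq (~s e₃) (~s e₂) (~s e₁) p<q
      long′ (out o) (out o′) sa sd                               = long-ok (old o sa) (old o′ sd)

    recoloured : ∃₂ (Good S′)
    recoloured = (λ u → F (position u)) , (λ u → M (position u)) , record
      { own-ok   = own′ (position _)
      ; adj-f    = adj-f′ (position _) (position _)
      ; adj-m    = adj-m′ (position _) (position _)
      ; short-ok = short′ (position _) (position _)
      ; long-ok  = long′ (position _) (position _)
      }

  -- Greedy: each degree-3 vertex of the list has its whole triangle recoloured, even one coloured
  -- before, against the colours present elsewhere.
  good-colours : ∀ xs → ∃₂ (Good (_∈ xs))
  good-colours [] = (λ _ → zero) , (λ _ → zero) , record
    { own-ok = λ () ; adj-f = λ () ; adj-m = λ () ; short-ok = λ () ; long-ok = λ () }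
  good-colours (x ∷ xs) with good-colours xs | core x
  ... | f , m , g | isolated ¬e = f , m , Good-anti (λ where
    (_ , _ , _ , claw e _ _ _ _ _) (here refl) → contradiction e ¬e
    _ (there v∈) → v∈) g
  ... | f , m , g | link t _ _ = f , m , Good-anti (λ where
    cv (here refl) → contradiction cv (Two⇒¬Cubic t)
    _ (there v∈) → v∈) g
  ... | f , m , g | hub h =
    let f′ , m′ , g′ = Recolour.recoloured (hub-triangle h (_ , _ , _ , Hub.claw-v h)) g
    in f′ , m′ , Good-anti (λ where
      _ (here refl) → inj₂ (zero , refl)
      _ (there v∈)  → inj₁ v∈) g′

  -- The fifth colour and the colouring of all vertices.

  module _ {f m : Fin n → Fin 4} (good : Good (λ _ → ⊤) f m) where
    open Good good

    private
      long-colour : {A : Set} → Dec A → Fin n → Fin 5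
      long-colour (yes _) a = inject₁ (m a)
      long-colour (no  _) a = fromℕ 4

      -- `fromℕ 4` is the fifth colour, `inject₁` embeds the other four. Isolated vertices get the
      -- fifth by default.
      colour : ∀ {v} → Core v → Fin 5
      colour     (isolated _)                  = fromℕ 4
      colour {v} (hub _)                       = inject₁ (f v)
      colour     (link _ _ (inj₁ _))           = fromℕ 4
      colour {v} (link {a} {q} _ _ (inj₂ _)) = long-colour (v <? q) a

      isolated-far : ∀ {u v} → (∀ {w} → ¬ u ~ w) → ¬ Near G u v
      isolated-far ¬e (inj₁ e)           = ¬e e
      isolated-far ¬e (inj₂ (_ , e , _)) = ¬e e

      hub⇒cubic : ∀ {v b c p} → Hub v b c p → Cu v
      hub⇒cubic h = _ , _ , _ , Hub.claw-v h

      -- A common neighbour of degree 3 puts `u` and `v` on one triangle; one of degree 2 makes them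
      -- the ends of a short arm.
      cubic-near-cubic : ∀ {u v} → Cu u → Cu v → u ≢ v → Near G u v → f u ≢ f v
      cubic-near-cubic cu cv u≢v (inj₁ e) = adj-f tt tt cu cv e
      cubic-near-cubic cu cv u≢v (inj₂ (w , e , e′)) with core w
      ... | isolated ¬e = contradiction e′ ¬e
      ... | link t _ _  = short-ok tt tt cu cv (Two⇒¬Cubic t) u≢v e e′
      ... | hub h       = adj-f tt tt cu cv (cubic-neighbours-adjacent (hub⇒cubic h) (~s e) cu e′ cv u≢v)

      -- Here `v` carries the colour missing at the triangle of `a`. Either `u` is on that triangle,
      -- or it is the far end of the arm, where `long-ok` applies.
      cubic-near-long : ∀ {u v a q d} → Cu u → Two v a q → Cu a → Two q v d →
                        v Fin.< q → u ≢ v → Near G u v → f u ≢ m a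
      cubic-near-long cu (mkTwo v~a v~q _ o) ca t′ v<q u≢v (inj₁ e) with o (~s e)
      ... | inj₁ refl = own-ok tt cu
      ... | inj₂ refl = contradiction cu (Two⇒¬Cubic t′)
      cubic-near-long cu t@(mkTwo v~a v~q _ o) ca t′ v<q u≢v (inj₂ (w , e , e′)) with o (~s e′)
      ... | inj₁ refl = λ eq → own-ok tt cu (trans eq (adj-m tt tt ca cu (~s e)))
      ... | inj₂ refl with Two.only t′ (~s e)
      ...   | inj₁ refl = contradiction refl u≢v
      ...   | inj₂ refl =
        ≢-sym (long-ok tt tt ca cu (Two⇒¬Cubic t) (Two⇒¬Cubic t′) (~s v~a) v~q (~s e) v<q)

      hub-link : ∀ {u v a q} → Cu u → (t : Two v a q) (ca : Cu a) (e : Cu q ⊎ ∃ (Two q v)) →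
                 u ≢ v → Near G u v → inject₁ (f u) ≢ colour (link t ca e)
      hub-link cu t ca (inj₁ _) u≢v nr eq = fromℕ≢inject₁ (sym eq)
      hub-link {v = v} {q = q} cu t ca (inj₂ (d , t′)) u≢v nr eq with v <? q
      ... | yes v<q = cubic-near-long cu t ca t′ v<q u≢v nr (inject₁-injective eq)
      ... | no  _   = fromℕ≢inject₁ (sym eq)

      linked : ∀ {u v a q} → Two u a q → Cu a → ¬ Cu v → u ~ v → v ≡ q
      linked (mkTwo _ _ _ o) ca ¬cv e with o e
      ... | inj₁ refl = contradiction ca ¬cv
      ... | inj₂ v≡q  = v≡q

      -- Degree-2 vertices with a common neighbour coincide, since each neighbour has at most one
      -- neighbour not of degree 3. Adjacent ones are the middle of a long arm, and exactly one of
      -- them is the smaller.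
      link-link : ∀ {u v a q b r} →
                  (t : Two u a q) (ca : Cu a) (e : Cu q ⊎ ∃ (Two q u)) →
                  (t′ : Two v b r) (cb : Cu b) (e′ : Cu r ⊎ ∃ (Two r v)) →
                  u ≢ v → Near G u v → colour (link t ca e) ≢ colour (link t′ cb e′)
      link-link t ca e t′ cb e′ u≢v (inj₂ (w , u~w , w~v)) with core w
      ... | isolated ¬e = contradiction w~v ¬e
      ... | hub h       = contradiction
        (outer-unique (hub⇒cubic h) (~s u~w) (Two⇒¬Cubic t) w~v (Two⇒¬Cubic t′)) u≢v
      ... | link t″ cc _ = contradiction
        (trans (linked t″ cc (Two⇒¬Cubic t) (~s u~w)) (sym (linked t″ cc (Two⇒¬Cubic t′) w~v))) u≢v
      link-link {u} {v} t ca e t′ cb e′ u≢v (inj₁ u~v)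
        with linked t ca (Two⇒¬Cubic t′) u~v | linked t′ cb (Two⇒¬Cubic t) (~s u~v) | e | e′
      ... | refl | refl | inj₁ cv | _       = contradiction cv (Two⇒¬Cubic t′)
      ... | refl | refl | inj₂ _  | inj₁ cu = contradiction cu (Two⇒¬Cubic t)
      ... | refl | refl | inj₂ _  | inj₂ _  with u <? v | v <? u
      ...   | yes u<v | yes v<u = contradiction v<u (<-asym u<v)
      ...   | yes _   | no _    = fromℕ≢inject₁ ∘ sym
      ...   | no _    | yes _   = fromℕ≢inject₁
      ...   | no u≮v  | no v≮u  with <-cmp u v
      ...     | tri< u<v _ _ = contradiction u<v u≮v
      ...     | tri≈ _ u≡v _ = contradiction u≡v u≢v
      ...     | tri> _ _ v<u = contradiction v<u v≮u

      proper : ∀ {u v} (x : Core u) (y : Core v) → u ≢ v → Near G u v → colour x ≢ colour y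
      proper (isolated ¬e)  _               u≢v nr = contradiction nr (isolated-far ¬e)
      proper (link _ _ _)   (isolated ¬e)   u≢v nr = contradiction (Near-sym G nr) (isolated-far ¬e)
      proper (hub _)        (isolated ¬e)   u≢v nr = contradiction (Near-sym G nr) (isolated-far ¬e)
      proper (link t ca e)  (link t′ cb e′) u≢v nr = link-link t ca e t′ cb e′ u≢v nr
      proper (link t ca e)  (hub h)         u≢v nr =
        ≢-sym (hub-link (hub⇒cubic h) t ca e (≢-sym u≢v) (Near-sym G nr))
      proper (hub h)        (link t ca e)   u≢v nr = hub-link (hub⇒cubic h) t ca e u≢v nr
      proper (hub h)        (hub h′)        u≢v nr =
        cubic-near-cubic (hub⇒cubic h) (hub⇒cubic h′) u≢v nr ∘ inject₁-injective

    good⇒colourable : Colourable G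
    good⇒colourable = (λ v → colour (core v)) , λ _ _ → proper (core _) (core _)

  colourable : Colourable G
  colourable = let _ , _ , g = good-colours (allFin n) in good⇒colourable (Good-anti (λ _ _ → ∈-allFin _) g)

-- From admissible graphs to packing colourings.

admissible⇒colourable : ∀ {n} (G : Graph n) → Admissible G → Colourable G
admissible⇒colourable = reduce λ G ad → case Local.core-or-reducible G ad of λ where
  (inj₁ r)    → inj₁ r
  (inj₂ core) → inj₂ (Irreducible.colourable G ad core)

theorem5 : ∀ {n} (G : Graph n) → Subcubic G → Saturated G 2 → G3Is G 3 →
    PackingColourable G (2 ∷ 2 ∷ 2 ∷ 2 ∷ 2 ∷ [])
theorem5 G sub sat g₃ =
  let c , proper = admissible⇒colourable G (hypotheses⇒admissible G sub sat g₃)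
  in c , λ u v u≢v cu≡cv (k , k≤s , walk) →
       proper (λ ()) (λ ()) u≢v
         -- The sequence is `replicate 5 2`, so the distance bound is 2 for every colour.
         (near u≢v (subst (k ≤_) (lookup-replicate (c u) 2) k≤s) walk) cu≡cv
  where
  near : ∀ {u v k} → u ≢ v → k ≤ 2 → Walk G k u v → Near G u v
  near u≢v _ here                                        = contradiction refl u≢v
  near _   _ (there e here)                              = inj₁ e
  near _   _ (there e (there e′ here))                   = inj₂ (_ , e , e′)
  near _   (s≤s (s≤s ())) (there _ (there _ (there _ _)))
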